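{- Let $n\geq 2$ and let $f=1^{x_{1}}0^{y_{1}}1^{x_{2}}0^{y_{2}}\cdots 1^{x_{n}}0^{y_{n}}$ with integers $x_i\geq 1$, $y_i\geq 1$ for $i=1,\ldots,n$. If $x_{n}\geq x_{1}+1$ and $y_{1}=y_{n}$, then $Q_{d}(f)\not\hookrightarrow Q_{d}$ for all $d\geq 2\sum_{i=2}^{n}x_{i}+2\sum_{i=2}^{n-1}y_{i}+3y_{1}+x_{1}-1$ (an empty sum being $0$).
   Context: All strings are binary; $1^a$ (resp. $0^a$) denotes the string of $a$ consecutive ones (resp. zeros), and juxtaposition is concatenation. $Q_d$ is the $d$-dimensional hypercube: its vertices are the binary strings of length $d$, two being adjacent iff they differ in exactly one bit. A string $f$ is a factor of $\mu$ if $f$ appears as $|f|$ consecutive bits of $\mu$. The generalized Fibonacci cube $Q_d(f)$ is the subgraph of $Q_d$ induced by all strings of length $d$ that do not contain $f$ as a factor. A subgraph $H$ of a connected graph $G$ is an isometric subgraph, written $H\hookrightarrow G$ (and $H\not\hookrightarrow G$ otherwise), if $d_H(\mu,\nu)=d_G(\mu,\nu)$ for all $\mu,\nu\in V(H)$ (with $d_H=\infty$ for vertices in different components of $H$). -}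

module Defs where

open import Data.Bool.Base using (Bool; true; false)
open import Data.List.Base using (List; _++_; replicate; concat; sum; applyUpTo)
open import Data.List.Relation.Binary.Infix.Heterogeneous using (Infix)
open import Data.Nat.Base using (ℕ; zero; suc; _+_; _∸_; _≤_)
open import Data.Product.Base using (_×_; _,_)
open import Data.Product using (∃!)
open import Data.Refinement using (Refinement; value)
open import Data.Vec.Base using (Vec; lookup; toList)
open import Function.Base using (_∘_)
open import Function.Bundles using (_⇔_)
open import Relation.Binary.PropositionalEquality using (_≡_; _≢_; refl; ≢-sym)
open import Relation.Nullary.Negation using (¬_)

record Graph : Set₁ where
  field
    Vertex  : Set
    Adj     : Vertex → Vertex → Set
    symm    : ∀ {u v} → Adj u v → Adj v u
    irrefl  : ∀ {u} → ¬ Adj u u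

open Graph public

data Walk (G : Graph) : Vertex G → Vertex G → ℕ → Set where
  nil  : ∀ {u} → Walk G u u zero
  cons : ∀ {u w v k} → Adj G u w → Walk G w v k → Walk G u v (suc k)

-- d_G(u,v) = k.  No k satisfies this when u and v lie in different
-- components, which is how d_G(u,v) = ∞ is represented.
IsDistance : (G : Graph) → Vertex G → Vertex G → ℕ → Set
IsDistance G u v k = Walk G u v k × (∀ m → Walk G u v m → k ≤ m)

-- Refinement makes the membership proof irrelevant, so a vertex of the
-- subgraph is determined by the underlying vertex of G.
record Subgraph (G : Graph) : Set₁ where
  field
    Member : Vertex G → Set
    Edge   : Refinement (Vertex G) Member → Refinement (Vertex G) Member → Set
    edge-symm : ∀ {u v} → Edge u v → Edge v u
    edge⇒adj  : ∀ {u v} → Edge u v → Adj G (value u) (value v)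

toGraph : {G : Graph} → Subgraph G → Graph
toGraph {G} H = record
  { Vertex = Refinement (Vertex G) Member
  ; Adj    = Edge
  ; symm   = edge-symm
  ; irrefl = λ e → irrefl G (edge⇒adj e)
  }
  where open Subgraph H

induced : (G : Graph) → (Vertex G → Set) → Subgraph G
induced G P = record
  { Member    = P
  ; Edge      = λ u v → Adj G (value u) (value v)
  ; edge-symm = symm G
  ; edge⇒adj  = λ e → e
  }

-- d_H(u,v) = d_G(u,v) for all u, v in H: two distances, possibly ∞, are
-- equal iff they take the same finite values.
IsIsometric : {G : Graph} → Subgraph G → Set
IsIsometric {G} H = ∀ (u v : Vertex (toGraph H)) (k : ℕ) →
  IsDistance (toGraph H) u v k ⇔ IsDistance G (value u) (value v) k

DifferInOneBit : ∀ {d} → Vec Bool d → Vec Bool d → Set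
DifferInOneBit u v = ∃! _≡_ (λ i → lookup u i ≢ lookup v i)

Q : ℕ → Graph
Q d = record
  { Vertex = Vec Bool d
  ; Adj    = DifferInOneBit
  ; symm   = λ (i , u≢v , unique) → i , ≢-sym u≢v , λ v≢u → unique (≢-sym v≢u)
  ; irrefl = λ (_ , u≢u , _) → u≢u refl
  }

IsFactorOf : List Bool → List Bool → Set
IsFactorOf = Infix _≡_

FibonacciCube : (d : ℕ) → List Bool → Subgraph (Q d)
FibonacciCube d f = induced (Q d) (λ μ → ¬ IsFactorOf f (toList μ))

-- 1^{x 1} 0^{y 1} ⋯ 1^{x n} 0^{y n}; only the values of x and y at
-- 1, …, n are used.
blocks : (x y : ℕ → ℕ) → ℕ → List Bool
blocks x y n = concat (applyUpTo (block ∘ suc) n)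
  where
  block : ℕ → List Bool
  block i = replicate (x i) true ++ replicate (y i) false

-- Σ_{i=a}^{b} g i, which is 0 when b < a.
sumFromTo : ℕ → ℕ → (ℕ → ℕ) → ℕ
sumFromTo a b g = sum (applyUpTo (λ k → g (a + k)) (suc b ∸ a))

{-# OPTIONS --safe #-}

-- Write f = 1^x g 0^y with x = x₁ and y = y₁ = yₙ.  Then g = 0^y 1 R, and since
-- xₙ > x also g = G′ 1^x 1.  Shifted by |f| - (x + y + 1), two copies of f overlap
-- with exactly two mismatches: the word 1^x G′ 1^x a 0^(y-1) b R 0^(y+k) contains
-- f for (a , b) = (1 , 0) and for (a , b) = (0 , 1).  For (0 , 0) and (1 , 1) it
-- does not.  Indeed g starts with 0 and ends with 1, whereas after the prefix 1^x
-- and the next letter the word for (1 , 1) has period |g| - 1 up to its last 1, so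
-- g can occur only right after 1^x, where too few zeros follow it.  In the word for
-- (0 , 0) the same comparison leaves only the offset of a, and 0^(y+1) starts there.
-- So these two vertices, at distance 2 in the hypercube, have no common neighbour
-- in the subgraph.
module Submission where

open import Defs
open import Data.Bool.Base using (Bool; true; false)
open import Data.Bool.Properties using (_≟_)
open import Data.Empty using (⊥; ⊥-elim-irr)
open import Data.Fin.Base using (zero; suc)
open import Data.Fin.Properties using (suc-injective)
open import Data.Irrelevant using () renaming ([_] to irr)
open import Data.List.Base
  using (List; []; _∷_; _++_; length; replicate; concat; applyUpTo)
open import Data.List.Properties
  using (++-assoc; ++-identityʳ; length-++; length-replicate; applyUpTo-∷ʳ; concat-++)
open import Data.List.Relation.Binary.Infix.Heterogeneous
  using (MkView; toView; fromView)
open import Data.List.Relation.Binary.Pointwise using (Pointwise-≡⇒≡; ≡⇒Pointwise-≡)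
open import Data.Nat.Base using (ℕ; zero; suc; _+_; _*_; _∸_; _≤_; _≥_; pred; z≤n; s≤s)
open import Data.Nat.ListAction using (sum)
open import Data.Nat.ListAction.Properties using (sum-++)
open import Data.Nat.Properties
  using (+-commutativeSemigroup; +-identityʳ; +-suc; +-comm; m≤n⇒∃[o]m+o≡n)
open import Data.Nat.Solver using (module +-*-Solver)
open import Algebra.Properties.CommutativeSemigroup +-commutativeSemigroup
  using (x∙yz≈y∙xz; interchange; xy∙z≈xz∙y)
open import Data.Product.Base using (_×_; _,_; ∃; ∃₂)
open import Data.Refinement.Base using (_,_)
open import Data.Sum.Base as Sum using (_⊎_; inj₁; inj₂)
open import Data.Vec.Base as Vec using (Vec; []; _∷_; fromList; toList; lookup)
open import Data.Vec.Properties
  using (toList-++; toList∘fromList; ++-injectiveʳ; ∷-injectiveˡ; ∷-injectiveʳ;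
         tabulate∘lookup; tabulate-cong)
open import Function.Base using (_∘_)
open import Function.Bundles using (module Equivalence)
open import Relation.Binary.PropositionalEquality
  using (_≡_; _≢_; refl; sym; trans; cong; cong₂; subst; module ≡-Reasoning)
open import Relation.Nullary.Decidable using (yes; no)
open import Relation.Nullary.Negation using (¬_; contradiction)

private
  variable
    d p q s : ℕ
    a b : Bool

-- Adjacency in the hypercube, letter by letter.

differ-here : {u : Vec Bool d} → a ≢ b → DifferInOneBit (a ∷ u) (b ∷ u)
differ-here {a = a} {b} {u} a≢b = zero , a≢b , unique
  where
  unique : ∀ {i} → lookup (a ∷ u) i ≢ lookup (b ∷ u) i → zero ≡ i
  unique {zero}  _   = refl
  unique {suc _} u≢u = contradiction refl u≢u

differ-there : {u v : Vec Bool d} → DifferInOneBit u v → DifferInOneBit (a ∷ u) (a ∷ v)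
differ-there {a = a} {u} {v} (i , u≢v , unique) = suc i , u≢v , unique-there
  where
  unique-there : ∀ {j} → lookup (a ∷ u) j ≢ lookup (a ∷ v) j → suc i ≡ j
  unique-there {zero}  a≢a = contradiction refl a≢a
  unique-there {suc _} u≢v = cong suc (unique u≢v)

differ-++ : (P : Vec Bool p) {u v : Vec Bool d} →
            DifferInOneBit u v → DifferInOneBit (P Vec.++ u) (P Vec.++ v)
differ-++ []      uv = uv
differ-++ (_ ∷ P) uv = differ-there (differ-++ P uv)

-- Uniqueness of the differing index gives both cases: when it is the head, a disagreement in the
-- tails would be a second index; when it lies in the tails, so would a disagreement of the heads.
differ-∷⁻ : {u v : Vec Bool d} → DifferInOneBit (a ∷ u) (b ∷ v) →
            (a ≡ b × DifferInOneBit u v) ⊎ (a ≢ b × u ≡ v)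
differ-∷⁻ {u = u} {v} (zero , a≢b , unique) =
  inj₂ (a≢b , trans (sym (tabulate∘lookup u)) (trans (tabulate-cong agree) (tabulate∘lookup v)))
  where
  agree : ∀ i → lookup u i ≡ lookup v i
  agree i with lookup u i ≟ lookup v i
  ... | yes eq = eq
  ... | no u≢v with () ← unique {suc i} u≢v
differ-∷⁻ {a = a} {b} (suc i , u≢v , unique) with a ≟ b
... | yes a≡b = inj₁ (a≡b , i , u≢v , suc-injective ∘ unique)
... | no  a≢b with () ← unique {zero} a≢b

-- Squares in the hypercube and their opposite corners.

module _ (Z : Vec Bool q) (S : Vec Bool s) where

  -- The four fillings of the two slots span a 4-cycle, in which `(false , false)` and
  -- `(true , true)` are opposite corners.
  fill : Vec Bool p → Bool → Bool → Vec Bool (p + suc (q + suc s))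
  fill P a b = P Vec.++ a ∷ Z Vec.++ b ∷ S

  fill-injectiveʳ : (P : Vec Bool p) {a b a′ b′ : Bool} → fill P a b ≡ fill P a′ b′ → b ≡ b′
  fill-injectiveʳ P eq =
    ∷-injectiveˡ (++-injectiveʳ Z Z (∷-injectiveʳ (++-injectiveʳ P P eq)))

  fill-nonadjacent : (P : Vec Bool p) →
                     ¬ DifferInOneBit (fill P false false) (fill P true true)
  fill-nonadjacent []      uv with differ-∷⁻ uv
  ... | inj₂ (_ , eq) with () ← ∷-injectiveˡ (++-injectiveʳ Z Z eq)
  fill-nonadjacent (_ ∷ P) uv with differ-∷⁻ uv
  ... | inj₁ (_ , uv′)  = fill-nonadjacent P uv′
  ... | inj₂ (a≢a , _) = contradiction refl a≢a

  -- The first slot of `w` differs from that of exactly one end. This uses up the one allowed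
  -- difference, so everything after the slot agrees with that end.
  common-neighbour : (P : Vec Bool p) {w : Vec Bool (p + suc (q + suc s))} →
                     DifferInOneBit (fill P false false) w →
                     DifferInOneBit w (fill P true true) →
                     w ≡ fill P true false ⊎ w ≡ fill P false true
  common-neighbour [] {false ∷ w} _ wv with differ-∷⁻ wv
  ... | inj₂ (_ , refl) = inj₂ refl
  common-neighbour [] {true ∷ w} uw _ with differ-∷⁻ uw
  ... | inj₂ (_ , refl) = inj₁ refl
  common-neighbour (_ ∷ P) {_ ∷ w} uw wv with differ-∷⁻ uw | differ-∷⁻ wv
  ... | inj₁ (refl , uw′) | inj₁ (_ , wv′)   =
    Sum.map (cong (_ ∷_)) (cong (_ ∷_)) (common-neighbour P uw′ wv′)
  ... | inj₁ (refl , _)   | inj₂ (c≢c , _)   = contradiction refl c≢c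
  ... | inj₂ (a≢c , _)    | inj₁ (c≡a , _)   = contradiction (sym c≡a) a≢c
  -- A change inside `P` would leave `w` with the tails of both ends, whose second slots differ.
  ... | inj₂ (_ , refl)   | inj₂ (_ , eq)    with () ← fill-injectiveʳ P eq

  fill-distance : (P : Vec Bool p) → IsDistance (Q _) (fill P false false) (fill P true true) 2
  fill-distance P = cons {w = fill P true false} uw (cons wv nil) , shortest
    where
    uw : DifferInOneBit (fill P false false) (fill P true false)
    uw = differ-++ P (differ-here λ ())

    wv : DifferInOneBit (fill P true false) (fill P true true)
    wv = differ-++ P (differ-there (differ-++ Z (differ-here λ ())))

    walk₀ : ∀ {u v} → Walk (Q d) u v 0 → u ≡ v
    walk₀ nil = refl

    walk₁ : ∀ {u v} → Walk (Q d) u v 1 → DifferInOneBit u v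
    walk₁ (cons e nil) = e

    shortest : ∀ m → Walk (Q _) (fill P false false) (fill P true true) m → 2 ≤ m
    shortest 0 walk with () ← fill-injectiveʳ P (walk₀ walk)
    shortest 1 walk = contradiction (walk₁ walk) (fill-nonadjacent P)
    shortest (suc (suc m)) _ = s≤s (s≤s z≤n)

  midpoint : (P : Vec Bool p) {M : Vec Bool _ → Set} →
             ∀ {u v} → Walk (toGraph (induced (Q _) M))
                            (fill P false false , u) (fill P true true , v) 2 →
             ¬ M (fill P true false) → ¬ M (fill P false true) → ⊥
  midpoint P (cons {w = w , irr w∈M} uw (cons wv nil)) tf∉M ft∉M
    with common-neighbour P {w} uw wv
  -- The stored membership proof is irrelevant, so it may serve only to reach a contradiction.
  ... | inj₁ refl = ⊥-elim-irr (tf∉M w∈M)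
  ... | inj₂ refl = ⊥-elim-irr (ft∉M w∈M)

-- Isometry would turn the hypercube distance 2 between opposite corners into a walk of length 2
-- inside the subgraph, and its midpoint would be one of the two corners that contain `f`.
not-isometric : ∀ (P Z S f : List Bool) → let w = λ a b → P ++ a ∷ Z ++ b ∷ S in
                ¬ IsFactorOf f (w false false) → ¬ IsFactorOf f (w true true) →
                IsFactorOf f (w true false) → IsFactorOf f (w false true) →
                ¬ IsIsometric (FibonacciCube (length P + suc (length Z + suc (length S))) f)
not-isometric P Z S f ff∌f tt∌f tf∋f ft∋f isometric =
  let walk , _ = Equivalence.from (isometric (_ , irr (avoids ff∌f)) (_ , irr (avoids tt∌f)) 2)
                   (fill-distance (fromList Z) (fromList S) (fromList P))
  in midpoint (fromList Z) (fromList S) (fromList P) walk (contains tf∋f) (contains ft∋f)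
  where
  word : Bool → Bool → Vec Bool _
  word = fill (fromList Z) (fromList S) (fromList P)

  toList-word : ∀ a b → toList (word a b) ≡ P ++ a ∷ Z ++ b ∷ S
  toList-word a b
    rewrite toList-++ (fromList P) (a ∷ fromList Z Vec.++ b ∷ fromList S)
          | toList-++ (fromList Z) (b ∷ fromList S)
          | toList∘fromList P | toList∘fromList Z | toList∘fromList S = refl

  avoids : ¬ IsFactorOf f (P ++ a ∷ Z ++ b ∷ S) → ¬ IsFactorOf f (toList (word a b))
  avoids = subst (¬_ ∘ IsFactorOf f) (sym (toList-word _ _))

  contains : IsFactorOf f (P ++ a ∷ Z ++ b ∷ S) → ¬ ¬ IsFactorOf f (toList (word a b))
  contains i ¬i = ¬i (subst (IsFactorOf f) (sym (toList-word _ _)) i)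

-- Letters by position, and occurrences of factors.

-- The value beyond the end is false, so that trailing zeros are invisible.
_at_ : List Bool → ℕ → Bool
[]       at _     = false
(a ∷ _)  at zero  = a
(_ ∷ as) at suc i = as at i

infix 8 _at_

private
  variable
    as bs cs : List Bool

at-++ʳ : ∀ as i → (as ++ bs) at (length as + i) ≡ bs at i
at-++ʳ []       i = refl
at-++ʳ (_ ∷ as) i = at-++ʳ as i

at-length : ∀ as → (as ++ bs) at length as ≡ bs at 0
at-length []       = refl
at-length (_ ∷ as) = at-length as

at-++-replicate : ∀ n i → (replicate n a ++ bs) at (n + i) ≡ bs at i
at-++-replicate zero    i = refl
at-++-replicate (suc n) i = at-++-replicate n i

at-zeros : ∀ n i → replicate n false at i ≡ false
at-zeros zero    i       = refl
at-zeros (suc n) zero    = refl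
at-zeros (suc n) (suc i) = at-zeros n i

-- A `true` comes neither from the padding zeros nor from the default value, so its position lies
-- inside `as`.
at-++-true : ∀ as c i → (as ++ replicate c false) at i ≡ true → (as ++ bs) at i ≡ true
at-++-true []       c i       eq with () ← trans (sym (at-zeros c i)) eq
at-++-true (_ ∷ as) c zero    eq = eq
at-++-true (_ ∷ as) c (suc i) eq = at-++-true as c i eq

at-last-zero : ∀ z → (replicate (suc z) false ++ bs) at z ≡ false
at-last-zero zero    = refl
at-last-zero (suc z) = at-last-zero z

at-zeros-++-true : ∀ n i → (replicate n false ++ bs) at i ≡ true →
                   ∃ λ j → i ≡ n + j × bs at j ≡ true
at-zeros-++-true zero    i       eq = i , refl , eq
at-zeros-++-true (suc n) (suc i) eq with j , refl , eq′ ← at-zeros-++-true n i eq = j , refl , eq′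

-- Before position `length as` the two words agree, and after it the second one shows only the
-- default `false`.
at-mismatch : ∀ as i → (as ++ a ∷ bs) at i ≢ (as ++ b ∷ []) at i →
              (as ++ b ∷ []) at i ≡ true → i ≡ length as
at-mismatch []       zero    _  _ = refl
at-mismatch (_ ∷ as) zero    ne _ = contradiction refl ne
at-mismatch (_ ∷ as) (suc i) ne t = cong suc (at-mismatch as i ne t)

infix-at : IsFactorOf as bs → ∃₂ λ q cs → ∀ i → bs at (q + i) ≡ (as ++ cs) at i
infix-at factor with MkView pref pw suff ← toView factor with refl ← Pointwise-≡⇒≡ pw =
  length pref , suff , at-++ʳ pref

-- Cancelling the common prefix 1^x shifts positions equally in both words, so the offset `q` is
-- kept.
occurrence : ∀ x → IsFactorOf (replicate x true ++ as) (replicate x true ++ bs) →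
             ∃₂ λ q cs → ∀ i → bs at (q + i) ≡ (as ++ cs) at i
occurrence {as} {bs} x factor with q , cs , eq ← infix-at factor = q , cs , λ i → begin
  bs at (q + i)                             ≡⟨ at-++-replicate x (q + i) ⟨
  (replicate x true ++ bs) at (x + (q + i)) ≡⟨ cong ((replicate x true ++ bs) at_) (x∙yz≈y∙xz x q i) ⟩
  (replicate x true ++ bs) at (q + (x + i)) ≡⟨ eq (x + i) ⟩
  ((replicate x true ++ as) ++ cs) at (x + i)
    ≡⟨ cong (_at (x + i)) (++-assoc (replicate x true) as cs) ⟩
  (replicate x true ++ as ++ cs) at (x + i) ≡⟨ at-++-replicate x i ⟩
  (as ++ cs) at i                           ∎
  where open ≡-Reasoning

-- The words with equal slots avoid `f`.

module _ (z : ℕ) {G R : List Bool} where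

  private
    -- With y = z + 1, the word g is `false ∷ T`; the assumption `G1≡0T` below also writes it as `G`
    -- followed by a 1.
    T = replicate z false ++ true ∷ R
    f = λ x → replicate x true ++ (false ∷ T) ++ replicate (suc z) false

  module _ (G1≡0T : G ++ true ∷ [] ≡ false ∷ T) where

    length-T : length T ≡ length G
    length-T = cong pred (begin
      suc (length T)          ≡⟨ cong length G1≡0T ⟨
      length (G ++ true ∷ []) ≡⟨ length-++ G ⟩
      length G + 1            ≡⟨ +-comm (length G) 1 ⟩
      suc (length G)          ∎)
      where open ≡-Reasoning

    last-true : ∀ bs → (false ∷ T ++ bs) at length G ≡ true
    last-true bs = begin
      (false ∷ T ++ bs) at length G        ≡⟨ cong (λ l → (l ++ bs) at length G) G1≡0T ⟨
      ((G ++ true ∷ []) ++ bs) at length G ≡⟨ cong (_at length G) (++-assoc G _ bs) ⟩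
      (G ++ true ∷ bs) at length G         ≡⟨ at-length G ⟩
      true                                 ∎
      where open ≡-Reasoning

    first-true : ∀ bs → (T ++ bs) at z ≡ true
    first-true bs = begin
      (T ++ bs) at z                                   ≡⟨ cong (_at z) (++-assoc (replicate z false) _ bs) ⟩
      (replicate z false ++ true ∷ R ++ bs) at z       ≡⟨ cong ((replicate z false ++ true ∷ R ++ bs) at_) (+-identityʳ z) ⟨
      (replicate z false ++ true ∷ R ++ bs) at (z + 0) ≡⟨ at-++-replicate z 0 ⟩
      true                                             ∎
      where open ≡-Reasoning

    occurrence-f : ∀ x → IsFactorOf (f x) (replicate x true ++ bs) →
                   ∃₂ λ q cs → ∀ i → bs at (q + i) ≡ (false ∷ T ++ replicate (suc z) false ++ cs) at i
    occurrence-f x factor with q , cs , eq ← occurrence x factor =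
      q , cs , λ i → trans (eq i) (cong (_at i) (++-assoc (false ∷ T) _ cs))

    avoids-11 : ∀ x c → ¬ IsFactorOf (f x)
      (replicate x true ++ (false ∷ T) ++ T ++ replicate c false)
    avoids-11 x c factor with occurrence-f x factor
    -- At offset 0 the final zeros of `f` meet the start of the second `T`, whose letter at index
    -- `z` is 1.
    ... | zero , cs , eq = contradiction (begin
      true                                                  ≡⟨ first-true (replicate c false) ⟨
      (T ++ replicate c false) at z                         ≡⟨ at-++ʳ T z ⟨
      (T ++ T ++ replicate c false) at (length T + z)       ≡⟨ eq (suc (length T + z)) ⟩
      (T ++ replicate (suc z) false ++ cs) at (length T + z) ≡⟨ at-++ʳ T z ⟩
      (replicate (suc z) false ++ cs) at z                  ≡⟨ at-last-zero z ⟩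
      false                                                 ∎) λ ()
      where open ≡-Reasoning
    -- The last 1 of g lands on letter `r` of what follows the first `T`, hence on a letter of the
    -- second `T`. The first 0 of g lands on letter `r` of the first `T`, which is the same letter.
    ... | suc r , cs , eq = contradiction (begin
      true                                      ≡⟨ at-++-true T c r (begin
        (T ++ replicate c false) at r                    ≡⟨ at-++ʳ T r ⟨
        (T ++ T ++ replicate c false) at (length T + r)  ≡⟨ cong ((T ++ T ++ replicate c false) at_) shift ⟩
        (T ++ T ++ replicate c false) at (r + length G)  ≡⟨ eq (length G) ⟩
        (false ∷ T ++ replicate (suc z) false ++ cs) at length G ≡⟨ last-true _ ⟩
        true                                             ∎) ⟨
      (T ++ T ++ replicate c false) at r        ≡⟨ cong ((T ++ T ++ replicate c false) at_) (+-identityʳ r) ⟨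
      (T ++ T ++ replicate c false) at (r + 0)  ≡⟨ eq 0 ⟩
      false                                     ∎) λ ()
      where
      open ≡-Reasoning
      shift : length T + r ≡ r + length G
      shift = trans (+-comm (length T) r) (cong (r +_) length-T)

    avoids-00 : ∀ x c → ¬ IsFactorOf (f x)
      (replicate x true ++ G ++ false ∷ replicate (suc z) false ++ R ++ replicate c false)
    avoids-00 x c factor with occurrence-f x factor
    ... | zero , cs , eq = contradiction
      (trans (sym (last-true _)) (trans (sym (eq (length G))) (at-length G))) λ ()
    -- Once the offset is known to be `length G`, the first 1 of g, at index `suc z`, meets the last
    -- of the `suc z` zeros behind the first slot.
    ... | suc r , cs , eq = contradiction (begin
      true                                             ≡⟨ first-true _ ⟨
      (false ∷ T ++ replicate (suc z) false ++ cs) at suc z ≡⟨ eq (suc z) ⟨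
      w at (suc r + suc z)                             ≡⟨ cong (λ m → w at (m + suc z)) r+1≡∣G∣ ⟩
      w at (length G + suc z)                          ≡⟨ at-++ʳ G (suc z) ⟩
      (replicate (suc z) false ++ R ++ replicate c false) at z ≡⟨ at-last-zero z ⟩
      false                                            ∎) λ ()
      where
      open ≡-Reasoning
      w : List Bool
      w = G ++ false ∷ replicate (suc z) false ++ R ++ replicate c false

      -- The last 1 of g, at index `length G`, lands on index `r` of what follows the first slot.
      true-at-r : (replicate (suc z) false ++ R ++ replicate c false) at r ≡ true
      true-at-r = begin
        (replicate (suc z) false ++ R ++ replicate c false) at r ≡⟨ at-++ʳ G (suc r) ⟨
        w at (length G + suc r)                                  ≡⟨ cong (w at_) (+-comm (length G) (suc r)) ⟩
        w at (suc r + length G)                                  ≡⟨ eq (length G) ⟩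
        (false ∷ T ++ replicate (suc z) false ++ cs) at length G ≡⟨ last-true _ ⟩
        true                                                     ∎

      -- That 1 lies in `R`, which starts at index `z + 1` behind the slot but at index `z + 2` of
      -- g; hence letter `suc r` of g is 1 as well.
      g-true : (G ++ true ∷ []) at suc r ≡ true
      g-true with j , refl , Rj ← at-zeros-++-true (suc z) r true-at-r = begin
        (G ++ true ∷ []) at (2 + (z + j))               ≡⟨ cong (_at (2 + (z + j))) G1≡0T ⟩
        (replicate z false ++ true ∷ R) at suc (z + j)  ≡⟨ cong ((replicate z false ++ true ∷ R) at_) (+-suc z j) ⟨
        (replicate z false ++ true ∷ R) at (z + suc j)  ≡⟨ at-++-replicate z (suc j) ⟩
        R at j                                          ≡⟨ cong (_at j) (++-identityʳ R) ⟨
        (R ++ []) at j                                  ≡⟨ at-++-true R c j Rj ⟩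
        true                                            ∎

      w-false : w at suc r ≡ false
      w-false = trans (cong (w at_) (sym (+-identityʳ (suc r)))) (eq 0)

      -- The first 0 of g lands on letter `suc r` of `w`, whereas g has a 1 at that same index. Only
      -- the slot position allows such a disagreement.
      r+1≡∣G∣ : suc r ≡ length G
      r+1≡∣G∣ = at-mismatch G (suc r)
        (λ agree → contradiction (trans (sym w-false) (trans agree g-true)) λ ()) g-true

-- The overlap of two copies of `f` and its length.

replicate-+ : ∀ m n → replicate (m + n) a ≡ replicate m a ++ replicate n a
replicate-+ zero    n = refl
replicate-+ (suc m) n = cong (_ ∷_) (replicate-+ m n)

replicate-++-∷ : ∀ n {as} → replicate n a ++ a ∷ as ≡ replicate (suc n) a ++ as
replicate-++-∷ zero    = refl
replicate-++-∷ (suc n) = cong (_ ∷_) (replicate-++-∷ n)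

factor : ∀ as bs cs → IsFactorOf bs (as ++ bs ++ cs)
factor as bs cs = fromView (MkView as (≡⇒Pointwise-≡ refl) cs)

-- Reading g as G′ 1^x 1 lets the second copy of `f` start inside the first, at the 1^x before the
-- final 1 of g. The dimension is the length of the overlap plus `k` zeros of padding.
overlap-not-isometric : ∀ x z k G′ R →
  (G′ ++ replicate x true) ++ true ∷ [] ≡ replicate (suc z) false ++ true ∷ R →
  ∀ d → d ≡ x + 3 * suc z + 2 * suc (length R) ∸ 1 + k →
  ¬ IsIsometric (FibonacciCube d
      (replicate x true ++ (replicate (suc z) false ++ true ∷ R) ++ replicate (suc z) false))
overlap-not-isometric x z k G′ R G1≡0T d d≡ =
  subst (λ d → ¬ IsIsometric (FibonacciCube d f)) (trans length-word (sym d≡))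
    (not-isometric P Z S f
      (subst (¬_ ∘ IsFactorOf f) (sym word-00) (avoids-00 z G1≡0T x c))
      (subst (¬_ ∘ IsFactorOf f) (sym word-11) (avoids-11 z G1≡0T x c))
      (subst (IsFactorOf f) (sym word-10) (factor [] f S))
      (subst (IsFactorOf f) (sym word-01) (factor (replicate x true ++ G′) f (replicate k false))))
  where
  open ≡-Reasoning
  -- `suc z` zeros complete the second copy of `f`; the other `k` are padding.
  c = suc z + k
  1ˣ = replicate x true
  0ʸ = replicate (suc z) false
  G = G′ ++ 1ˣ
  Z = replicate z false
  T = Z ++ true ∷ R
  P = 1ˣ ++ G
  S = R ++ replicate c false
  f = 1ˣ ++ (false ∷ T) ++ 0ʸ

  G1-++ : ∀ as → G ++ true ∷ as ≡ false ∷ T ++ as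
  G1-++ as = trans (sym (++-assoc G _ as)) (cong (_++ as) G1≡0T)

  word-00 : P ++ false ∷ Z ++ false ∷ S ≡ 1ˣ ++ G ++ false ∷ 0ʸ ++ S
  word-00 = trans (++-assoc 1ˣ G _) (cong (λ as → 1ˣ ++ G ++ false ∷ as) (replicate-++-∷ z))

  word-11 : P ++ true ∷ Z ++ true ∷ S ≡ 1ˣ ++ (false ∷ T) ++ T ++ replicate c false
  word-11 = begin
    P ++ true ∷ Z ++ true ∷ S               ≡⟨ ++-assoc 1ˣ G _ ⟩
    1ˣ ++ G ++ true ∷ Z ++ true ∷ S         ≡⟨ cong (1ˣ ++_) (G1-++ _) ⟩
    1ˣ ++ false ∷ T ++ Z ++ true ∷ S        ≡⟨ cong (λ as → 1ˣ ++ false ∷ T ++ as) (++-assoc Z _ _) ⟨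
    1ˣ ++ false ∷ T ++ T ++ replicate c false ∎

  word-10 : P ++ true ∷ Z ++ false ∷ S ≡ f ++ S
  word-10 = begin
    P ++ true ∷ Z ++ false ∷ S         ≡⟨ ++-assoc 1ˣ G _ ⟩
    1ˣ ++ G ++ true ∷ Z ++ false ∷ S   ≡⟨ cong (1ˣ ++_) (G1-++ _) ⟩
    1ˣ ++ false ∷ T ++ Z ++ false ∷ S  ≡⟨ cong (λ as → 1ˣ ++ false ∷ T ++ as) (replicate-++-∷ z) ⟩
    1ˣ ++ false ∷ T ++ 0ʸ ++ S         ≡⟨ cong (1ˣ ++_) (++-assoc (false ∷ T) 0ʸ S) ⟨
    1ˣ ++ ((false ∷ T) ++ 0ʸ) ++ S     ≡⟨ ++-assoc 1ˣ _ S ⟨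
    f ++ S                             ∎

  word-01 : P ++ false ∷ Z ++ true ∷ S ≡ (1ˣ ++ G′) ++ f ++ replicate k false
  word-01 = begin
    P ++ false ∷ Z ++ true ∷ R ++ replicate c false
      ≡⟨ cong (_++ false ∷ Z ++ true ∷ S) (++-assoc 1ˣ G′ 1ˣ) ⟨
    ((1ˣ ++ G′) ++ 1ˣ) ++ false ∷ Z ++ true ∷ R ++ replicate c false
      ≡⟨ ++-assoc (1ˣ ++ G′) 1ˣ _ ⟩
    (1ˣ ++ G′) ++ 1ˣ ++ false ∷ Z ++ true ∷ R ++ replicate c false
      ≡⟨ cong (λ as → (1ˣ ++ G′) ++ 1ˣ ++ false ∷ as) (begin
         Z ++ true ∷ R ++ replicate c false            ≡⟨ ++-assoc Z _ _ ⟨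
         T ++ replicate c false                        ≡⟨ cong (T ++_) (replicate-+ (suc z) k) ⟩
         T ++ 0ʸ ++ replicate k false                  ≡⟨ ++-assoc T 0ʸ _ ⟨
         (T ++ 0ʸ) ++ replicate k false                ∎) ⟩
    (1ˣ ++ G′) ++ 1ˣ ++ ((false ∷ T) ++ 0ʸ) ++ replicate k false
      ≡⟨ cong ((1ˣ ++ G′) ++_) (++-assoc 1ˣ _ _) ⟨
    (1ˣ ++ G′) ++ f ++ replicate k false ∎

  length-P : length P ≡ x + (z + suc (length R))
  length-P = begin
    length P             ≡⟨ length-++ 1ˣ ⟩
    length 1ˣ + length G ≡⟨ cong₂ _+_ (length-replicate x) (sym (length-T z G1≡0T)) ⟩
    x + length T         ≡⟨ cong (x +_) (length-++ Z) ⟩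
    x + (length Z + suc (length R)) ≡⟨ cong (λ l → x + (l + suc (length R))) (length-replicate z) ⟩
    x + (z + suc (length R)) ∎

  length-S : length S ≡ length R + c
  length-S = trans (length-++ R) (cong (length R +_) (length-replicate c))

  length-word : length P + suc (length Z + suc (length S)) ≡ x + 3 * suc z + 2 * suc (length R) ∸ 1 + k
  length-word = begin
    length P + suc (length Z + suc (length S))
      ≡⟨ cong₂ _+_ length-P (cong₂ (λ l l′ → suc (l + suc l′)) (length-replicate z) length-S) ⟩
    x + (z + suc r) + suc (z + suc (r + c))
      ≡⟨ solve 4 (λ x z r k → x :+ (z :+ (con 1 :+ r)) :+ (con 1 :+ (z :+ (con 1 :+ (r :+ (con 1 :+ z :+ k)))))
                   := x :+ con 3 :* (con 1 :+ z) :+ (r :+ (con 1 :+ (r :+ con 0))) :+ k) refl x z r k ⟩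
    x + 3 * suc z + (r + suc (r + 0)) + k
      ≡⟨ cong (λ l → l ∸ 1 + k) (+-suc (x + 3 * suc z) _) ⟨
    x + 3 * suc z + 2 * suc r ∸ 1 + k ∎
    where
    open +-*-Solver
    r = length R

-- The block word: its outer runs and its length.

sum-applyUpTo-suc : ∀ (g : ℕ → ℕ) n → sum (applyUpTo g (suc n)) ≡ sum (applyUpTo g n) + g n
sum-applyUpTo-suc g n = begin
  sum (applyUpTo g (suc n))       ≡⟨ cong sum (applyUpTo-∷ʳ g n) ⟨
  sum (applyUpTo g n ++ g n ∷ []) ≡⟨ sum-++ (applyUpTo g n) (g n ∷ []) ⟩
  sum (applyUpTo g n) + (g n + 0) ≡⟨ cong (sum (applyUpTo g n) +_) (+-identityʳ (g n)) ⟩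
  sum (applyUpTo g n) + g n       ∎
  where open ≡-Reasoning

concat-applyUpTo-suc : ∀ (g : ℕ → List Bool) n → concat (applyUpTo g (suc n)) ≡ concat (applyUpTo g n) ++ g n
concat-applyUpTo-suc g n = begin
  concat (applyUpTo g (suc n))          ≡⟨ cong concat (applyUpTo-∷ʳ g n) ⟨
  concat (applyUpTo g n ++ g n ∷ [])    ≡⟨ concat-++ (applyUpTo g n) (g n ∷ []) ⟨
  concat (applyUpTo g n) ++ g n ++ []   ≡⟨ cong (concat (applyUpTo g n) ++_) (++-identityʳ (g n)) ⟩
  concat (applyUpTo g n) ++ g n         ∎
  where open ≡-Reasoning

module _ (x y : ℕ → ℕ) where

  private
    block : ℕ → List Bool
    block i = replicate (x i) true ++ replicate (y i) false

  length-block : ∀ i → length (block i) ≡ x i + y i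
  length-block i = trans (length-++ (replicate (x i) true))
                         (cong₂ _+_ (length-replicate (x i)) (length-replicate (y i)))

  -- A general reindexing `h` carries the induction, since each step of `applyUpTo` replaces `h` by
  -- `h ∘ suc`.
  length-blocks : ∀ (h : ℕ → ℕ) m → length (concat (applyUpTo (block ∘ h) m)) ≡
                  sum (applyUpTo (x ∘ h) m) + sum (applyUpTo (y ∘ h) m)
  length-blocks h zero    = refl
  length-blocks h (suc m) = begin
    length (block (h 0) ++ concat (applyUpTo (block ∘ h ∘ suc) m))
      ≡⟨ length-++ (block (h 0)) ⟩
    length (block (h 0)) + length (concat (applyUpTo (block ∘ h ∘ suc) m))
      ≡⟨ cong₂ _+_ (length-block (h 0)) (length-blocks (h ∘ suc) m) ⟩
    (x (h 0) + y (h 0)) + (sum (applyUpTo (x ∘ h ∘ suc) m) + sum (applyUpTo (y ∘ h ∘ suc) m))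
      ≡⟨ interchange (x (h 0)) _ _ _ ⟩
    (x (h 0) + sum (applyUpTo (x ∘ h ∘ suc) m)) + (y (h 0) + sum (applyUpTo (y ∘ h ∘ suc) m)) ∎
    where open ≡-Reasoning

  middle : ℕ → List Bool
  middle m = concat (applyUpTo (block ∘ (2 +_)) m)

  -- With n = 2 + m the parenthesised word is g: the first block is split off at the front and the
  -- last one at the back.
  blocks-split : ∀ m → blocks x y (2 + m) ≡
    replicate (x 1) true ++
    (replicate (y 1) false ++ middle m ++ replicate (x (2 + m)) true) ++
    replicate (y (2 + m)) false
  blocks-split m = begin
    (1¹ ++ 0¹) ++ concat (applyUpTo (block ∘ (2 +_)) (suc m))
      ≡⟨ cong ((1¹ ++ 0¹) ++_) (concat-applyUpTo-suc (block ∘ (2 +_)) m) ⟩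
    (1¹ ++ 0¹) ++ middle m ++ 1ⁿ ++ 0ⁿ   ≡⟨ ++-assoc 1¹ 0¹ _ ⟩
    1¹ ++ 0¹ ++ middle m ++ 1ⁿ ++ 0ⁿ     ≡⟨ cong (λ as → 1¹ ++ 0¹ ++ as) (++-assoc (middle m) 1ⁿ 0ⁿ) ⟨
    1¹ ++ 0¹ ++ (middle m ++ 1ⁿ) ++ 0ⁿ   ≡⟨ cong (1¹ ++_) (++-assoc 0¹ _ 0ⁿ) ⟨
    1¹ ++ (0¹ ++ middle m ++ 1ⁿ) ++ 0ⁿ   ∎
    where
    open ≡-Reasoning
    1¹ = replicate (x 1) true
    0¹ = replicate (y 1) false
    1ⁿ = replicate (x (2 + m)) true
    0ⁿ = replicate (y (2 + m)) false

  -- This supplies the 1 that follows the leading zeros of g. It belongs to the run 1^(x₂), which is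
  -- the last run of ones when `m` is zero and opens the first middle block otherwise.
  middle-head : ∀ m → x 2 ≥ 1 → ∃ λ R → middle m ++ replicate (x (2 + m)) true ≡ true ∷ R
  middle-head zero    x₂≥1 with suc _ ← x 2 = _ , refl
  middle-head (suc m) x₂≥1 with suc _ ← x 2 = _ , refl

  -- This is the length of 1 R; doubled, it gives the two sums in the dimension bound.
  length-middle : ∀ m → length (middle m ++ replicate (x (2 + m)) true) ≡
                  sumFromTo 2 (2 + m) x + sumFromTo 2 (1 + m) y
  length-middle m = begin
    length (middle m ++ replicate (x (2 + m)) true)
      ≡⟨ length-++ (middle m) ⟩
    length (middle m) + length (replicate (x (2 + m)) true)
      ≡⟨ cong₂ _+_ (length-blocks (2 +_) m) (length-replicate (x (2 + m))) ⟩
    (sum (applyUpTo (x ∘ (2 +_)) m) + sum (applyUpTo (y ∘ (2 +_)) m)) + x (2 + m)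
      ≡⟨ xy∙z≈xz∙y (sum (applyUpTo (x ∘ (2 +_)) m)) _ _ ⟩
    (sum (applyUpTo (x ∘ (2 +_)) m) + x (2 + m)) + sum (applyUpTo (y ∘ (2 +_)) m)
      ≡⟨ cong (_+ sum (applyUpTo (y ∘ (2 +_)) m)) (sum-applyUpTo-suc (x ∘ (2 +_)) m) ⟨
    sum (applyUpTo (x ∘ (2 +_)) (suc m)) + sum (applyUpTo (y ∘ (2 +_)) m) ∎
    where open ≡-Reasoning

-- The parameters of the overlap.

lemma2p4 : ∀ (n : ℕ) → n ≥ 2 →
    ∀ (x y : ℕ → ℕ) →
    (∀ i → 1 ≤ i → i ≤ n → x i ≥ 1) →
    (∀ i → 1 ≤ i → i ≤ n → y i ≥ 1) →
    x n ≥ x 1 + 1 →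
    y 1 ≡ y n →
    ∀ (d : ℕ) →
    d ≥ 2 * sumFromTo 2 n x + 2 * sumFromTo 2 (n ∸ 1) y + 3 * y 1 + x 1 ∸ 1 →
    ¬ IsIsometric (FibonacciCube d (blocks x y n))
lemma2p4 1 (s≤s ())
lemma2p4 n@(suc (suc m)) _ x y x≥1 y≥1 xₙ>x₁ y₁≡yₙ d d≥
  -- `z` is y₁ - 1, `e` is xₙ - x₁ - 1, and `k` is the excess of `d` over the bound.
  with z , 1+z≡y₁ ← m≤n⇒∃[o]m+o≡n (y≥1 1 (s≤s z≤n) (s≤s z≤n))
     | e , x₁+1+e≡xₙ ← m≤n⇒∃[o]m+o≡n xₙ>x₁
     | k , bound+k≡d ← m≤n⇒∃[o]m+o≡n d≥
     | R , head≡ ← middle-head x y m (x≥1 2 (s≤s z≤n) (s≤s (s≤s z≤n)))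
  = subst (λ f → ¬ IsIsometric (FibonacciCube d f)) (sym f≡)
      -- G′ is g without its last x₁ + 1 ones, so it keeps the first `e` ones of the last run.
      (overlap-not-isometric (x 1) z k (0ʸ ++ middle x y m ++ 1ᵉ) R g≡ d d≡)
  where
  open ≡-Reasoning
  1ˣ = replicate (x 1) true
  1ᵉ = replicate e true
  1ⁿ = replicate (x n) true
  0ʸ = replicate (suc z) false

  f≡ : blocks x y n ≡ 1ˣ ++ (0ʸ ++ true ∷ R) ++ 0ʸ
  f≡ = begin
    blocks x y n
      ≡⟨ blocks-split x y m ⟩
    1ˣ ++ (replicate (y 1) false ++ middle x y m ++ 1ⁿ) ++ replicate (y n) false
      -- y₁ = yₙ turns the first and the last run of zeros into the same `0ʸ`.
      ≡⟨ cong₂ (λ l l′ → 1ˣ ++ (replicate l false ++ middle x y m ++ 1ⁿ) ++ replicate l′ false)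
               1+z≡y₁ (trans 1+z≡y₁ y₁≡yₙ) ⟨
    1ˣ ++ (0ʸ ++ middle x y m ++ 1ⁿ) ++ 0ʸ
      ≡⟨ cong (λ as → 1ˣ ++ (0ʸ ++ as) ++ 0ʸ) head≡ ⟩
    1ˣ ++ (0ʸ ++ true ∷ R) ++ 0ʸ ∎

  1ⁿ≡ : 1ⁿ ≡ 1ᵉ ++ 1ˣ ++ true ∷ []
  1ⁿ≡ = begin
    replicate (x n) true             ≡⟨ cong (λ l → replicate l true) (trans (+-comm e (x 1 + 1)) x₁+1+e≡xₙ) ⟨
    replicate (e + (x 1 + 1)) true   ≡⟨ replicate-+ e (x 1 + 1) ⟩
    1ᵉ ++ replicate (x 1 + 1) true   ≡⟨ cong (1ᵉ ++_) (replicate-+ (x 1) 1) ⟩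
    1ᵉ ++ 1ˣ ++ true ∷ []            ∎

  g≡ : ((0ʸ ++ middle x y m ++ 1ᵉ) ++ 1ˣ) ++ true ∷ [] ≡ 0ʸ ++ true ∷ R
  g≡ = begin
    ((0ʸ ++ middle x y m ++ 1ᵉ) ++ 1ˣ) ++ true ∷ []
      ≡⟨ ++-assoc (0ʸ ++ middle x y m ++ 1ᵉ) 1ˣ _ ⟩
    (0ʸ ++ middle x y m ++ 1ᵉ) ++ 1ˣ ++ true ∷ []
      ≡⟨ ++-assoc 0ʸ _ _ ⟩
    0ʸ ++ (middle x y m ++ 1ᵉ) ++ 1ˣ ++ true ∷ []
      ≡⟨ cong (0ʸ ++_) (++-assoc (middle x y m) 1ᵉ _) ⟩
    0ʸ ++ middle x y m ++ 1ᵉ ++ 1ˣ ++ true ∷ []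
      ≡⟨ cong (λ as → 0ʸ ++ middle x y m ++ as) 1ⁿ≡ ⟨
    0ʸ ++ middle x y m ++ 1ⁿ
      ≡⟨ cong (0ʸ ++_) head≡ ⟩
    0ʸ ++ true ∷ R ∎

  Σx = sumFromTo 2 n x
  Σy = sumFromTo 2 (n ∸ 1) y

  d≡ : d ≡ x 1 + 3 * suc z + 2 * suc (length R) ∸ 1 + k
  d≡ = begin
    d
      ≡⟨ bound+k≡d ⟨
    2 * Σx + 2 * Σy + 3 * y 1 + x 1 ∸ 1 + k
      ≡⟨ cong (λ l → l ∸ 1 + k) (rearrange (x 1) (y 1) Σx Σy) ⟩
    x 1 + 3 * y 1 + 2 * (Σx + Σy) ∸ 1 + k
      ≡⟨ cong₂ (λ l l′ → x 1 + 3 * l + 2 * l′ ∸ 1 + k) (sym 1+z≡y₁)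
               (trans (sym (length-middle x y m)) (cong length head≡)) ⟩
    x 1 + 3 * suc z + 2 * suc (length R) ∸ 1 + k ∎
    where
    open +-*-Solver
    rearrange : ∀ x y s t → 2 * s + 2 * t + 3 * y + x ≡ x + 3 * y + 2 * (s + t)
    rearrange = solve 4 (λ x y s t → con 2 :* s :+ con 2 :* t :+ con 3 :* y :+ x
                                       := x :+ con 3 :* y :+ con 2 :* (s :+ t)) refl
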